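{- Let the sequences of integers $(a_k)_{k\ge 0}$, $(b_k)$, $(c_k)$, $(d_k)$, $(e_k)$, $(f_k)$, $(p_k)$, $(q_k)$, $(r_k)$, $(s_k)$, $(t_k)$ be defined as the coefficients of the following power series expansions about $x=0$: \begin{align*} &\frac{x^2+164 x+3}{x^3-99 x^2+99 x-1}=\sum_{k=0}^{\infty}a_k x^k, && \frac{ -5 x^2+138 x+3}{x^3-99 x^2+99 x-1}=\sum_{k=0}^{\infty}p_k x^k,\\ &\frac{ -7 x^2+134 x+1}{x^3-99 x^2+99 x-1}=\sum_{k=0}^{\infty}b_k x^k, && \frac{3 x^2+244 x+1}{x^3-99 x^2+99 x-1}=\sum_{k=0}^{\infty}q_k x^k,\\ &\frac{ -x^2+298 x-1}{x^3-99 x^2+99 x-1}=\sum_{k=0}^{\infty}c_k x^k, && \frac{x^2+254 x-7}{x^3-99 x^2+99 x-1}=\sum_{k=0}^{\infty}r_k x^k,\\ &\frac{ -5 x^2+228 x-7}{x^3-99 x^2+99 x-1}=\sum_{k=0}^{\infty}d_k x^k, && \frac{ -7 x^2+148 x-5}{x^3-99 x^2+99 x-1}=\sum_{k=0}^{\infty}s_k x^k,\\ &\frac{3 x^2+258 x-5}{x^3-99 x^2+99 x-1}=\sum_{k=0}^{\infty}e_k x^k, && \frac{3}{1-x}=\sum_{k=0}^{\infty}t_k x^k,\\ &\frac{ -3 x^2+94 x-3}{x^3-99 x^2+99 x-1}=\sum_{k=0}^{\infty}f_k x^k. \end{align*} Then for every integer $j$ with $1\le j\le 5$ and every integer $k\ge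 0$, \[ a_k^j+b_k^j+c_k^j+d_k^j+e_k^j+f_k^j-p_k^j-q_k^j-r_k^j-s_k^j-t_k^j=1. \]
   Context: The sequences are the Taylor coefficients at $x=0$ of the given rational functions (all denominators are nonzero at $x=0$), equivalently formal power series identities. -}

module Defs where

open import Algebra.Properties.Monoid.Sum using (sum⁺-syntax)
open import Data.Fin.Base using (toℕ)
open import Data.Integer.Base using (ℤ; +_; -_; _*_; 0ℤ)
open import Data.Integer.Properties using (+-0-monoid)
open import Data.List.Base using (List; []; _∷_)
open import Data.Nat.Base using (ℕ; zero; suc; _∸_)
open import Relation.Binary.PropositionalEquality.Core using (_≡_)

-- A polynomial is its list of coefficients in ascending degree:
-- c₀ ∷ c₁ ∷ c₂ ∷ [] is c₀ + c₁ x + c₂ x².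
Polynomial : Set
Polynomial = List ℤ

-- The formal power series Σ aₖ xᵏ is the function k ↦ aₖ.
PowerSeries : Set
PowerSeries = ℕ → ℤ

⟦_⟧ : Polynomial → PowerSeries
⟦ []    ⟧ _       = 0ℤ
⟦ c ∷ _ ⟧ zero    = c
⟦ _ ∷ p ⟧ (suc k) = ⟦ p ⟧ k

infixl 7 _⊛_

-- Cauchy product.
_⊛_ : PowerSeries → PowerSeries → PowerSeries
(f ⊛ g) n = sum⁺-syntax +-0-monoid n (λ i → f (toℕ i) * g (n ∸ toℕ i))

infix 4 _/_≐∑_

-- num / den ≐∑ a says num(x) / den(x) = Σ aₖ xᵏ, read as the power series
-- identity den(x) · Σ aₖ xᵏ = num(x). It determines a when den(0) ≠ 0, and
-- when den(0) = ± 1 such an integer sequence a always exists.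
_/_≐∑_ : Polynomial → Polynomial → PowerSeries → Set
num / den ≐∑ a = ∀ n → (⟦ den ⟧ ⊛ a) n ≡ ⟦ num ⟧ n

-- x³ - 99 x² + 99 x - 1
D : Polynomial
D = - + 1 ∷ + 99 ∷ - + 99 ∷ + 1 ∷ []

{-# OPTIONS --safe #-}

-- Let h be the power series with x² / D = - h.  A sequence with generating
-- function (n₀ + n₁x + n₂x²) / D is a combination of the shifts of h, and
-- 1 - 98x + x² = D / (x - 1) shows that h k and h (k + 1) suffice, subject to
-- the quadratic invariant Q (h k) (h (k + 1)) = 0.  With the right-hand side 1
-- next to t = 3, the values pair off around 2:
-- a + d = b + e = c + f = p + r = q + s = t + 1 = 4.
-- Hence only the second and fourth powers of the deviations from 2 matter.  The
-- second powers balance identically and the fourth ones up to a multiple of Q.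
module Submission where

open import Defs
open import Data.Integer.Base using (ℤ; +_; -_; _+_; _-_; _*_; _^_; 0ℤ; 1ℤ)
open import Data.Integer.Properties using (+-identityʳ; +-identityˡ; *-zeroʳ; ^-zeroˡ)
open import Data.Integer.Tactic.RingSolver using (ring; solve-∀)
open import Data.Fin.Base using (zero; suc)
open import Data.List.Base using ([]; _∷_)
open import Data.Nat.Base as ℕ using (ℕ; zero; suc; _≤_; s≤s)
open import Data.Vec.Base using (Vec; []; _∷_)
open import Relation.Binary.PropositionalEquality.Core
  using (_≡_; refl; sym; trans; cong; cong₂)
open import Relation.Binary.PropositionalEquality.Properties
  using (module ≡-Reasoning)
open import Tactic.RingSolver.NonReflective ring using (Expr; Κ; Ι; _⊕_; _⊗_; ⊝_; module Ops)

-- Cauchy products with constant polynomials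

zero-⊛ : ∀ a n → (⟦ [] ⟧ ⊛ a) n ≡ 0ℤ
zero-⊛ a zero    = refl
zero-⊛ a (suc n) = trans (+-identityˡ ((⟦ [] ⟧ ⊛ a) n)) (zero-⊛ a n)

-- At a variable index a product with a denominator reduces only down to its last coefficient; this
-- evaluates the sum that remains.
constant-⊛ : ∀ c a n → (⟦ c ∷ [] ⟧ ⊛ a) n ≡ c * a n
constant-⊛ c a zero    = +-identityʳ (c * a 0)
constant-⊛ c a (suc n) = begin
  c * a (suc n) + (⟦ [] ⟧ ⊛ a) n  ≡⟨ cong (_+_ (c * a (suc n))) (zero-⊛ a n) ⟩
  c * a (suc n) + 0ℤ              ≡⟨ +-identityʳ (c * a (suc n)) ⟩
  c * a (suc n)                   ∎
  where open ≡-Reasoning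

-- The basic sequence and its quadratic invariant

h : PowerSeries
h 0             = 0ℤ
h 1             = 0ℤ
h (suc (suc k)) = 1ℤ + + 98 * h (suc k) - h k

Q : ℤ → ℤ → ℤ
Q z y = y * y + z * z - + 98 * (y * z) - y - z

-- Vieta jumping: `Q` is symmetric and contains `z` only through z (z - (98y + 1)), which the
-- reflection of `z` to 98y + 1 - z preserves.
Q-step : ∀ z y → Q y (1ℤ + + 98 * y - z) ≡ Q z y
Q-step = unfolded
  where
  unfolded : ∀ z y → let x = 1ℤ + + 98 * y - z in
    x * x + y * y - + 98 * (x * y) - x - y ≡
    y * y + z * z - + 98 * (y * z) - y - z
  unfolded = solve-∀

Q-h : ∀ k → Q (h k) (h (suc k)) ≡ 0ℤ
Q-h zero    = refl
Q-h (suc k) = trans (Q-step (h k) (h (suc k))) (Q-h k)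

-- Subtracting two consecutive instances of the defining recurrence removes the constant 1 and
-- leaves the recurrence with the coefficients of `D`.
h-recurrence : ∀ k →
  h (3 ℕ.+ k) ≡ + 99 * h (2 ℕ.+ k) - + 99 * h (suc k) + h k
h-recurrence k = identity (h (suc k)) (h k)
  where
  identity : ∀ y z → let x = 1ℤ + + 98 * y - z in
    1ℤ + + 98 * x - y ≡ + 99 * x - + 99 * y + z
  identity = solve-∀

-- As `D` has constant term -1, this extracts the newest term of a series from its coefficient
-- identity.
solve-head : ∀ {x y v} → - + 1 * x + y ≡ v → x ≡ y - v
solve-head {x} {y} refl = identity x y
  where
  identity : ∀ x y → x ≡ y - (- + 1 * x + y)
  identity = solve-∀

-- Quotients by `D` as combinations of shifts of `h`

combination : (n₀ n₁ n₂ : ℤ) → PowerSeries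
combination n₀ n₁ n₂ k = - (n₀ * h (2 ℕ.+ k) + n₁ * h (suc k) + n₂ * h k)

module _ {n₀ n₁ n₂} a (a-series : (n₀ ∷ n₁ ∷ n₂ ∷ []) / D ≐∑ a) where
  open ≡-Reasoning

  quotient-by-D : ∀ k → a k ≡ combination n₀ n₁ n₂ k
  quotient-by-D 0 = begin
    a 0                      ≡⟨ solve-head (a-series 0) ⟩
    0ℤ - n₀                  ≡⟨ identity n₀ n₁ n₂ ⟩
    combination n₀ n₁ n₂ 0   ∎
    where
    identity : ∀ u v w → 0ℤ - u ≡ - (u * 1ℤ + v * 0ℤ + w * 0ℤ)
    identity = solve-∀
  quotient-by-D 1 = begin
    a 1                                      ≡⟨ solve-head (a-series 1) ⟩
    + 99 * a 0 + 0ℤ - n₁                     ≡⟨ cong (λ x → + 99 * x + 0ℤ - n₁) (quotient-by-D 0) ⟩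
    + 99 * combination n₀ n₁ n₂ 0 + 0ℤ - n₁  ≡⟨ identity n₀ n₁ n₂ ⟩
    combination n₀ n₁ n₂ 1                   ∎
    where
    identity : ∀ u v w → + 99 * - (u * 1ℤ + v * 0ℤ + w * 0ℤ) + 0ℤ - v ≡
                         - (u * + 99 + v * 1ℤ + w * 0ℤ)
    identity = solve-∀
  quotient-by-D 2 = begin
    a 2
      ≡⟨ solve-head (a-series 2) ⟩
    + 99 * a 1 + (- + 99 * a 0 + 0ℤ) - n₂
      ≡⟨ cong₂ (λ x y → + 99 * x + (- + 99 * y + 0ℤ) - n₂) (quotient-by-D 1) (quotient-by-D 0) ⟩
    + 99 * combination n₀ n₁ n₂ 1 + (- + 99 * combination n₀ n₁ n₂ 0 + 0ℤ) - n₂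
      ≡⟨ identity n₀ n₁ n₂ ⟩
    combination n₀ n₁ n₂ 2
      ∎
    where
    -- The values `h 2`, `h 3`, `h 4` appear evaluated, as 1, 99 and 9702.
    identity : ∀ u v w →
      + 99 * - (u * + 99 + v * 1ℤ + w * 0ℤ) +
        (- + 99 * - (u * 1ℤ + v * 0ℤ + w * 0ℤ) + 0ℤ) - w ≡
      - (u * + 9702 + v * + 99 + w * 1ℤ)
    identity = solve-∀
  quotient-by-D (suc (suc (suc k))) = begin
    a (suc (suc (suc k)))
      ≡⟨ solve-head (a-series (3 ℕ.+ k)) ⟩
    + 99 * a (2 ℕ.+ k) + (- + 99 * a (suc k) + (⟦ + 1 ∷ [] ⟧ ⊛ a) k) - 0ℤ
      ≡⟨ cong (λ x → + 99 * a (2 ℕ.+ k) + (- + 99 * a (suc k) + x) - 0ℤ)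
              (constant-⊛ (+ 1) a k) ⟩
    + 99 * a (2 ℕ.+ k) + (- + 99 * a (suc k) + + 1 * a k) - 0ℤ
      ≡⟨ cong₂ (λ x y → + 99 * x + y - 0ℤ) (quotient-by-D (suc (suc k)))
           (cong₂ (λ x y → - + 99 * x + + 1 * y) (quotient-by-D (suc k)) (quotient-by-D k)) ⟩
    + 99 * combination n₀ n₁ n₂ (2 ℕ.+ k) +
      (- + 99 * combination n₀ n₁ n₂ (suc k) + + 1 * combination n₀ n₁ n₂ k) - 0ℤ
      ≡⟨ identity n₀ n₁ n₂ (h (4 ℕ.+ k)) (h (3 ℕ.+ k)) (h (2 ℕ.+ k)) (h (suc k)) (h k) ⟩
    - (n₀ * shifted (2 ℕ.+ k) + n₁ * shifted (suc k) + n₂ * shifted k)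
      ≡⟨ cong -_ (cong₂ _+_ (cong₂ _+_
           (cong (n₀ *_) (h-recurrence (2 ℕ.+ k)))
           (cong (n₁ *_) (h-recurrence (suc k))))
           (cong (n₂ *_) (h-recurrence k))) ⟨
    combination n₀ n₁ n₂ (3 ℕ.+ k)
      ∎
    where
    shifted : PowerSeries
    shifted i = + 99 * h (2 ℕ.+ i) - + 99 * h (suc i) + h i
    identity : ∀ u v w x₄ x₃ x₂ x₁ x₀ →
      + 99 * - (u * x₄ + v * x₃ + w * x₂) +
        (- + 99 * - (u * x₃ + v * x₂ + w * x₁) + + 1 * - (u * x₂ + v * x₁ + w * x₀)) - 0ℤ ≡
      - (u * (+ 99 * x₄ - + 99 * x₃ + x₂) + v * (+ 99 * x₃ - + 99 * x₂ + x₁) +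
         w * (+ 99 * x₂ - + 99 * x₁ + x₀))
    identity = solve-∀

-- Deviations from 2

open Ops using (norm; correct; homo) renaming (⟦_⟧ to ⟦_⟧ᵉ)

Z Y : Expr ℤ 2
Z = Ι zero
Y = Ι (suc zero)

infixl 6 _⊖_
_⊖_ : ∀ {n} → Expr ℤ n → Expr ℤ n → Expr ℤ n
e₁ ⊖ e₂ = e₁ ⊕ (⊝ e₂)

h-pair : ℕ → Vec ℤ 2
h-pair k = h k ∷ h (suc k) ∷ []

-- This is 2 minus the combination, with `h (2 + k)` eliminated by the recurrence. It is kept as
-- syntax so that identities between deviations can be checked on normal forms.
deviation : (n₀ n₁ n₂ : ℤ) → Expr ℤ 2
deviation n₀ n₁ n₂ = Κ (+ 98 * n₀ + n₁) ⊗ Y ⊕ Κ (n₂ - n₀) ⊗ Z ⊕ Κ (n₀ + + 2)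

below-two : ∀ {n₀ n₁ n₂} a → (n₀ ∷ n₁ ∷ n₂ ∷ []) / D ≐∑ a → ∀ k →
  a k ≡ + 2 - ⟦ deviation n₀ n₁ n₂ ⟧ᵉ (h-pair k)
below-two {n₀} {n₁} {n₂} a a-series k =
  trans (quotient-by-D a a-series k) (identity n₀ n₁ n₂ (h (suc k)) (h k))
  where
  identity : ∀ u v w y z →
    - (u * (1ℤ + + 98 * y - z) + v * y + w * z) ≡
    + 2 - ((+ 98 * u + v) * y + (w - u) * z + (u + + 2))
  identity = solve-∀

-- The constant sequence 4 has numerator - 4 + 392x - 4x², so the deviation
-- on the right is that of 4 - a k.
above-two : ∀ {n₀ n₁ n₂} a → (n₀ ∷ n₁ ∷ n₂ ∷ []) / D ≐∑ a → ∀ k →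
  a k ≡ + 2 + ⟦ deviation (- + 4 - n₀) (+ 392 - n₁) (- + 4 - n₂) ⟧ᵉ (h-pair k)
above-two {n₀} {n₁} {n₂} a a-series k =
  trans (quotient-by-D a a-series k) (identity n₀ n₁ n₂ (h (suc k)) (h k))
  where
  identity : ∀ u v w y z →
    - (u * (1ℤ + + 98 * y - z) + v * y + w * z) ≡
    + 2 + ((+ 98 * (- + 4 - u) + (+ 392 - v)) * y +
           ((- + 4 - w) - (- + 4 - u)) * z + ((- + 4 - u) + + 2))
  identity = solve-∀

geometric-constant : ∀ {c} a → (c ∷ []) / (+ 1 ∷ - + 1 ∷ []) ≐∑ a → ∀ k → a k ≡ c
geometric-constant {c} a a-series zero = begin
  a 0              ≡⟨ identity (a 0) ⟩
  + 1 * a 0 + 0ℤ   ≡⟨ a-series 0 ⟩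
  c                ∎
  where
  open ≡-Reasoning
  identity : ∀ x → x ≡ + 1 * x + 0ℤ
  identity = solve-∀
geometric-constant {c} a a-series (suc k) = begin
  a (suc k)  ≡⟨ identity (a (suc k)) (a k) ⟩
  + 1 * a (suc k) + - + 1 * a k + a k
    ≡⟨ cong (λ x → + 1 * a (suc k) + x + a k) (constant-⊛ (- + 1) a k) ⟨
  + 1 * a (suc k) + (⟦ - + 1 ∷ [] ⟧ ⊛ a) k + a k
    ≡⟨ cong₂ _+_ (a-series (suc k)) (geometric-constant a a-series k) ⟩
  0ℤ + c     ≡⟨ +-identityˡ c ⟩
  c          ∎
  where
  open ≡-Reasoning
  identity : ∀ x y → x ≡ + 1 * x + - + 1 * y + y
  identity = solve-∀

-- Power sums of paired values

balance : (ℤ → ℤ) → (A B C P R : ℤ) → ℤ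
balance g A B C P R = g A + g B + g C - g P - g R - g 1ℤ

symmetric-power : ℕ → ℤ → ℤ
symmetric-power j x = (+ 2 - x) ^ j + (+ 2 + x) ^ j

balanced-power-sums : ∀ {A B C P R a b c d e f p q r s t} →
  balance (λ x → x * x) A B C P R ≡ 0ℤ →
  balance (λ x → x * x * (x * x)) A B C P R ≡ 0ℤ →
  a ≡ + 2 - A → b ≡ + 2 - B → c ≡ + 2 - C →
  d ≡ + 2 + A → e ≡ + 2 + B → f ≡ + 2 + C →
  p ≡ + 2 - P → q ≡ + 2 - R → r ≡ + 2 + P → s ≡ + 2 + R → t ≡ + 3 →
  ∀ j → 1 ≤ j → j ≤ 5 →
  a ^ j + b ^ j + c ^ j + d ^ j + e ^ j + f ^ j
    - p ^ j - q ^ j - r ^ j - s ^ j - t ^ j ≡ + 1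
balanced-power-sums {A} {B} {C} {P} {R} squares fourths
  refl refl refl refl refl refl refl refl refl refl refl = power-sum
  where
  open ≡-Reasoning

  -- Odd powers of the deviation cancel within a pair. `α` cancels because three pairs stand on each
  -- side, the third negative one being 1 and 3 with deviation 1.
  power-sum-of : ∀ j α β γ →
    (∀ x → symmetric-power j x ≡ α + β * (x * x) + γ * (x * x * (x * x))) →
    (+ 2 - A) ^ j + (+ 2 - B) ^ j + (+ 2 - C) ^ j + (+ 2 + A) ^ j + (+ 2 + B) ^ j + (+ 2 + C) ^ j
      - (+ 2 - P) ^ j - (+ 2 - R) ^ j - (+ 2 + P) ^ j - (+ 2 + R) ^ j - (+ 3) ^ j ≡ + 1
  power-sum-of j α β γ even = begin
    (+ 2 - A) ^ j + (+ 2 - B) ^ j + (+ 2 - C) ^ j + (+ 2 + A) ^ j + (+ 2 + B) ^ j + (+ 2 + C) ^ j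
      - (+ 2 - P) ^ j - (+ 2 - R) ^ j - (+ 2 + P) ^ j - (+ 2 + R) ^ j - (+ 3) ^ j
      -- Adding and subtracting `1ℤ ^ j` gives `(+ 3) ^ j` its partner.
      ≡⟨ pair-up ((+ 2 - A) ^ j) ((+ 2 - B) ^ j) ((+ 2 - C) ^ j)
                 ((+ 2 + A) ^ j) ((+ 2 + B) ^ j) ((+ 2 + C) ^ j)
                 ((+ 2 - P) ^ j) ((+ 2 - R) ^ j) ((+ 2 + P) ^ j) ((+ 2 + R) ^ j)
                 ((+ 3) ^ j) (1ℤ ^ j) ⟩
    balance (symmetric-power j) A B C P R + 1ℤ ^ j
      ≡⟨ cong (_+_ (balance (symmetric-power j) A B C P R)) (^-zeroˡ j) ⟩
    balance (symmetric-power j) A B C P R + 1ℤ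
      ≡⟨ cong (_+ 1ℤ) (cong₂ _-_ (cong₂ _-_ (cong₂ _-_
           (cong₂ _+_ (cong₂ _+_ (even A) (even B)) (even C)) (even P)) (even R)) (even 1ℤ)) ⟩
    balance (λ x → α + β * (x * x) + γ * (x * x * (x * x))) A B C P R + 1ℤ
      ≡⟨ cong (_+ 1ℤ) (collect α β γ
           (A * A) (B * B) (C * C) (P * P) (R * R) 1ℤ
           (A * A * (A * A)) (B * B * (B * B)) (C * C * (C * C)) (P * P * (P * P)) (R * R * (R * R)) 1ℤ) ⟩
    β * balance (λ x → x * x) A B C P R + γ * balance (λ x → x * x * (x * x)) A B C P R + 1ℤ
      ≡⟨ cong₂ (λ x y → β * x + γ * y + 1ℤ) squares fourths ⟩
    β * 0ℤ + γ * 0ℤ + 1ℤ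
      ≡⟨ cong₂ (λ x y → x + y + 1ℤ) (*-zeroʳ β) (*-zeroʳ γ) ⟩
    1ℤ ∎
    where
    pair-up : ∀ a b c d e f p q r s t u →
      a + b + c + d + e + f - p - q - r - s - t ≡
      (a + d) + (b + e) + (c + f) - (p + r) - (q + s) - (u + t) + u
    pair-up = solve-∀
    collect : ∀ α β γ a b c p q u a′ b′ c′ p′ q′ u′ →
      (α + β * a + γ * a′) + (α + β * b + γ * b′) + (α + β * c + γ * c′)
        - (α + β * p + γ * p′) - (α + β * q + γ * q′) - (α + β * u + γ * u′) ≡
      β * (a + b + c - p - q - u) + γ * (a′ + b′ + c′ - p′ - q′ - u′)
    collect = solve-∀

  power-sum : ∀ j → 1 ≤ j → j ≤ 5 → _
  -- By the binomial theorem the coefficients of 1, x², x⁴ are twice C(j,i) 2^(j-i) for i = 0, 2, 4.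
  power-sum 1 _ _ = power-sum-of 1 (+ 4) (+ 0) (+ 0) even
    where
    even : ∀ x → (+ 2 - x) * 1ℤ + (+ 2 + x) * 1ℤ ≡
                 + 4 + + 0 * (x * x) + + 0 * (x * x * (x * x))
    even = solve-∀
  power-sum 2 _ _ = power-sum-of 2 (+ 8) (+ 2) (+ 0) even
    where
    even : ∀ x → (+ 2 - x) * ((+ 2 - x) * 1ℤ) + (+ 2 + x) * ((+ 2 + x) * 1ℤ) ≡
                 + 8 + + 2 * (x * x) + + 0 * (x * x * (x * x))
    even = solve-∀
  power-sum 3 _ _ = power-sum-of 3 (+ 16) (+ 12) (+ 0) even
    where
    even : ∀ x → (+ 2 - x) * ((+ 2 - x) * ((+ 2 - x) * 1ℤ)) +
                 (+ 2 + x) * ((+ 2 + x) * ((+ 2 + x) * 1ℤ)) ≡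
                 + 16 + + 12 * (x * x) + + 0 * (x * x * (x * x))
    even = solve-∀
  power-sum 4 _ _ = power-sum-of 4 (+ 32) (+ 48) (+ 2) even
    where
    even : ∀ x → (+ 2 - x) * ((+ 2 - x) * ((+ 2 - x) * ((+ 2 - x) * 1ℤ))) +
                 (+ 2 + x) * ((+ 2 + x) * ((+ 2 + x) * ((+ 2 + x) * 1ℤ))) ≡
                 + 32 + + 48 * (x * x) + + 2 * (x * x * (x * x))
    even = solve-∀
  power-sum 5 _ _ = power-sum-of 5 (+ 64) (+ 160) (+ 20) even
    where
    even : ∀ x → (+ 2 - x) * ((+ 2 - x) * ((+ 2 - x) * ((+ 2 - x) * ((+ 2 - x) * 1ℤ)))) +
                 (+ 2 + x) * ((+ 2 + x) * ((+ 2 + x) * ((+ 2 + x) * ((+ 2 + x) * 1ℤ)))) ≡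
                 + 64 + + 160 * (x * x) + + 20 * (x * x * (x * x))
    even = solve-∀
  power-sum (suc (suc (suc (suc (suc (suc _)))))) _ (s≤s (s≤s (s≤s (s≤s (s≤s ())))))

-- Polynomial identities for the second and fourth powers

-- Normal forms are compared as polynomials here.  solve-∀ compares their values,
-- where Agda unfolds the product of a literal and a variable in unary, which is
-- hopeless for coefficients of the size that occurs below.
same-normal-form : ∀ {n} (e₁ e₂ : Expr ℤ n) → norm e₁ ≡ norm e₂ →
  ∀ ρ → ⟦ e₁ ⟧ᵉ ρ ≡ ⟦ e₂ ⟧ᵉ ρ
same-normal-form e₁ e₂ e₁≡e₂ ρ = begin
  ⟦ e₁ ⟧ᵉ ρ           ≡⟨ correct e₁ ρ ⟨
  ⟦ norm e₁ ⟧ᵖ ρ      ≡⟨ cong (λ p → ⟦ p ⟧ᵖ ρ) e₁≡e₂ ⟩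
  ⟦ norm e₂ ⟧ᵖ ρ      ≡⟨ correct e₂ ρ ⟩
  ⟦ e₂ ⟧ᵉ ρ           ∎
  where
  open ≡-Reasoning
  open import Tactic.RingSolver.Core.Polynomial.Semantics homo
    using () renaming (⟦_⟧ to ⟦_⟧ᵖ)

balanceᵉ : ∀ {n} → (Expr ℤ n → Expr ℤ n) → (A B C P R : Expr ℤ n) → Expr ℤ n
balanceᵉ g A B C P R = g A ⊕ g B ⊕ g C ⊖ g P ⊖ g R ⊖ g (Κ 1ℤ)

-- For variable expressions these hold by refl at once.  At the expressions used
-- below the same conversion would unfold products in unary again.
module _ {n} (A B C P R : Expr ℤ n) (ρ : Vec ℤ n) where
  square-balance : ⟦ balanceᵉ (λ e → e ⊗ e) A B C P R ⟧ᵉ ρ ≡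
    balance (λ x → x * x) (⟦ A ⟧ᵉ ρ) (⟦ B ⟧ᵉ ρ) (⟦ C ⟧ᵉ ρ) (⟦ P ⟧ᵉ ρ) (⟦ R ⟧ᵉ ρ)
  square-balance = refl

  fourth-balance : ⟦ balanceᵉ (λ e → e ⊗ e ⊗ (e ⊗ e)) A B C P R ⟧ᵉ ρ ≡
    balance (λ x → x * x * (x * x)) (⟦ A ⟧ᵉ ρ) (⟦ B ⟧ᵉ ρ) (⟦ C ⟧ᵉ ρ) (⟦ P ⟧ᵉ ρ) (⟦ R ⟧ᵉ ρ)
  fourth-balance = refl

-- The first five come from the numerators of a, b, c, p and q, in this order; d, e, f, r and s have
-- the opposite deviations.
A B C P R Qᵉ cofactor : Expr ℤ 2
A = deviation (+ 3) (+ 164) (+ 1)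
B = deviation (+ 1) (+ 134) (- + 7)
C = deviation (- + 1) (+ 298) (- + 1)
P = deviation (+ 3) (+ 138) (- + 5)
R = deviation (+ 1) (+ 244) (+ 3)
Qᵉ = Y ⊗ Y ⊕ Z ⊗ Z ⊖ Κ (+ 98) ⊗ (Y ⊗ Z) ⊖ Y ⊖ Z
-- The quotient of the balance of the fourth powers by Q.
cofactor = Κ (- + 1920) ⊗
  (Κ (+ 5800) ⊗ (Y ⊗ Y) ⊖ Κ (+ 200) ⊗ (Y ⊗ Z) ⊕ Κ (+ 158) ⊗ Y ⊖ Κ (+ 2) ⊗ Z ⊕ Κ 1ℤ)

value-of-Qᵉ : ∀ z y → ⟦ Qᵉ ⟧ᵉ (z ∷ y ∷ []) ≡ Q z y
value-of-Qᵉ z y = refl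

balanced-squares : ∀ ρ →
  balance (λ x → x * x) (⟦ A ⟧ᵉ ρ) (⟦ B ⟧ᵉ ρ) (⟦ C ⟧ᵉ ρ) (⟦ P ⟧ᵉ ρ) (⟦ R ⟧ᵉ ρ) ≡ 0ℤ
balanced-squares ρ = trans (sym (square-balance A B C P R ρ))
  (same-normal-form (balanceᵉ (λ e → e ⊗ e) A B C P R) (Κ 0ℤ) refl ρ)

balanced-fourths : ∀ ρ → ⟦ Qᵉ ⟧ᵉ ρ ≡ 0ℤ →
  balance (λ x → x * x * (x * x)) (⟦ A ⟧ᵉ ρ) (⟦ B ⟧ᵉ ρ) (⟦ C ⟧ᵉ ρ) (⟦ P ⟧ᵉ ρ) (⟦ R ⟧ᵉ ρ) ≡ 0ℤ
balanced-fourths ρ Qᵉ≡0 = trans (sym (fourth-balance A B C P R ρ))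
  (trans fourths≡cofactor*Q (product-zero cofactor Qᵉ ρ Qᵉ≡0))
  where
  fourths≡cofactor*Q : ⟦ balanceᵉ (λ e → e ⊗ e ⊗ (e ⊗ e)) A B C P R ⟧ᵉ ρ ≡ ⟦ cofactor ⊗ Qᵉ ⟧ᵉ ρ
  fourths≡cofactor*Q =
    same-normal-form (balanceᵉ (λ e → e ⊗ e ⊗ (e ⊗ e)) A B C P R) (cofactor ⊗ Qᵉ) refl ρ
  -- Generic in the expressions, for the same reason as `fourth-balance`.
  product-zero : ∀ {n} (e₁ e₂ : Expr ℤ n) ρ → ⟦ e₂ ⟧ᵉ ρ ≡ 0ℤ → ⟦ e₁ ⊗ e₂ ⟧ᵉ ρ ≡ 0ℤ
  product-zero e₁ e₂ ρ e₂≡0 = trans (cong (⟦ e₁ ⟧ᵉ ρ *_) e₂≡0) (*-zeroʳ (⟦ e₁ ⟧ᵉ ρ))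

theorem2p1 :
  (a b c d e f p q r s t : ℕ → ℤ) →
  (  + 3 ∷ + 164 ∷   + 1 ∷ []) / D ≐∑ a →
  (  + 1 ∷ + 134 ∷ - + 7 ∷ []) / D ≐∑ b →
  (- + 1 ∷ + 298 ∷ - + 1 ∷ []) / D ≐∑ c →
  (- + 7 ∷ + 228 ∷ - + 5 ∷ []) / D ≐∑ d →
  (- + 5 ∷ + 258 ∷   + 3 ∷ []) / D ≐∑ e →
  (- + 3 ∷  + 94 ∷ - + 3 ∷ []) / D ≐∑ f →
  (  + 3 ∷ + 138 ∷ - + 5 ∷ []) / D ≐∑ p →
  (  + 1 ∷ + 244 ∷   + 3 ∷ []) / D ≐∑ q →
  (- + 7 ∷ + 254 ∷   + 1 ∷ []) / D ≐∑ r →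
  (- + 5 ∷ + 148 ∷ - + 7 ∷ []) / D ≐∑ s →
  (+ 3 ∷ []) / (+ 1 ∷ - + 1 ∷ []) ≐∑ t →
  (j : ℕ) → 1 ≤ j → j ≤ 5 → (k : ℕ) →
  a k ^ j + b k ^ j + c k ^ j + d k ^ j + e k ^ j + f k ^ j
    - p k ^ j - q k ^ j - r k ^ j - s k ^ j - t k ^ j ≡ + 1
theorem2p1 a b c d e f p q r s t a-series b-series c-series d-series e-series f-series
  p-series q-series r-series s-series t-series j 1≤j j≤5 k =
  balanced-power-sums
    {⟦ A ⟧ᵉ (h-pair k)} {⟦ B ⟧ᵉ (h-pair k)} {⟦ C ⟧ᵉ (h-pair k)} {⟦ P ⟧ᵉ (h-pair k)} {⟦ R ⟧ᵉ (h-pair k)}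
    {a k} {b k} {c k} {d k} {e k} {f k} {p k} {q k} {r k} {s k} {t k}
    (balanced-squares (h-pair k))
    (balanced-fourths (h-pair k) (trans (value-of-Qᵉ (h k) (h (suc k))) (Q-h k)))
    (below-two a a-series k) (below-two b b-series k) (below-two c c-series k)
    -- Reflection turns the numerators of d, e, f into those of a, b, c by computation: for d, -4 +
    -- 7 = 3, 392 - 228 = 164 and -4 + 5 = 1. Likewise r and s become p and q.
    (above-two d d-series k) (above-two e e-series k) (above-two f f-series k)
    (below-two p p-series k) (below-two q q-series k)
    (above-two r r-series k) (above-two s s-series k)
    (geometric-constant t t-series k) j 1≤j j≤5
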